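{- Almost all graphs have proper connection number $2$; that is, the number of graphs on $n$ labeled vertices that are connected and have $pc(G)=2$, divided by the total number $2^{\binom n2}$ of graphs on these vertices, tends to $1$ as $n\to\infty$.
   Context: All graphs are finite, simple and undirected. In an edge-colored graph (adjacent edges may receive the same color), a path is proper if no two adjacent edges of the path have the same color. For a nontrivial connected graph $G$, the proper connection number $pc(G)$ is the minimum number of colors in an edge-coloring of $G$ such that every two distinct vertices of $G$ are connected by at least one proper path. -}

module Defs where

open import Data.Bool.Base using (Bool; true; false; T)
open import Data.Empty using (⊥-elim)
open import Data.Fin.Base using (Fin; zero; suc)
open import Data.Fin.Properties as Fin using (any?; all?; injective⇒≤)
open import Data.Fin.Subset using (Subset)
open import Data.Integer.Base using (+_)
open import Data.List.Base using (List; []; _∷_; [_]; length; map; _++_; filter; cartesianProductWith)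
import Data.List.Base as List
import Data.List.Membership.Propositional as ∈ₚ
open import Data.List.Membership.Propositional.Properties
  using (∈-map⁺; ∈-map⁻; ∈-++⁺ˡ; ∈-++⁺ʳ; ∈-lookup)
import Data.List.Membership.Setoid as ∈ₛ
import Data.List.Membership.Setoid.Properties as ∈ₛₚ
open import Data.List.Relation.Unary.All using ([])
import Data.List.Relation.Unary.All as All
open import Data.List.Relation.Unary.AllPairs using ([]; _∷_; allPairs?)
open import Data.List.Relation.Unary.Any using (here)
open import Data.List.Relation.Unary.Linked using (Linked; linked?)
open import Data.List.Relation.Unary.Unique.Propositional using (Unique)
import Data.List.Relation.Unary.Unique.Propositional.Properties as Uniqueₚ
import Data.List.Relation.Unary.Unique.Setoid as Uniqueₛ
import Data.List.Relation.Unary.Unique.Setoid.Properties as Uniqueₛₚ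
open import Data.Nat.Base using (ℕ; zero; suc; _^_; _≤_; _<_; z≤n; s≤s; NonZero)
open import Data.Nat.Combinatorics using (_C_)
open import Data.Nat.Properties using (m^n≢0; allUpTo?)
open import Data.Product.Base using (Σ; ∃; ∃-syntax; _×_; _,_; proj₁; proj₂)
open import Data.Rational.Base as ℚ using (ℚ; 0ℚ; 1ℚ)
open import Data.Vec.Base using ([]; _∷_; lookup; tabulate)
open import Data.Vec.Properties using (lookup∘tabulate; tabulate∘lookup; tabulate-cong; ∷-injective)
open import Function.Base using (_∘_)
open import Level using (0ℓ)
open import Relation.Binary.Bundles using (Setoid)
open import Relation.Binary.Core using (Rel)
open import Relation.Binary.Construct.Closure.ReflexiveTransitive using (Star; ε; _◅_)
open import Relation.Binary.Definitions
  using (Symmetric; Irreflexive; Reflexive; _Respects_)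
open import Relation.Binary.PropositionalEquality
  using (_≡_; _≢_; refl; sym; trans; cong; cong₂; subst; setoid)
open import Relation.Nullary.Decidable
  using (Dec; yes; no; ¬?; _×-dec_; map′; _→-dec_)
open import Relation.Nullary.Negation using (¬_; contradiction)
open import Relation.Unary using (Pred; Decidable)

record Graph (n : ℕ) : Set where
  field
    adj : Fin n → Fin n → Bool

  Adj : Rel (Fin n) 0ℓ
  Adj u v = T (adj u v)

  field
    Adj-sym    : Symmetric Adj
    Adj-irrefl : Irreflexive _≡_ Adj

  Walk : Rel (Fin n) 0ℓ
  Walk = Star Adj

  vertices : ∀ {u v} → Walk u v → List (Fin n)
  vertices {u} ε       = [ u ]
  vertices {u} (_ ◅ w) = u ∷ vertices w

  IsPath : ∀ {u v} → Walk u v → Set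
  IsPath w = Unique (vertices w)

  Connected : Set
  Connected = ∀ u v → ∃[ w ] IsPath {u} {v} w

open Graph

-- Only actual edges are colored, with colors from Fin k; an edge has the
-- same color in both directions.

record EdgeColoring {n} (G : Graph n) (k : ℕ) : Set where
  field
    color     : ∀ u v → Adj G u v → Fin k
    color-sym : ∀ u v (e : Adj G u v) → color v u (Adj-sym G e) ≡ color u v e

  colors : ∀ {u v} → Walk G u v → List (Fin k)
  colors ε       = []
  colors (e ◅ w) = color _ _ e ∷ colors w

  IsProperPath : ∀ {u v} → Walk G u v → Set
  IsProperPath w = IsPath G w × Linked _≢_ (colors w)

  ProperlyConnected : Set
  ProperlyConnected = ∀ u v → u ≢ v → ∃[ w ] IsProperPath {u} {v} w

open EdgeColoring

ProperlyConnectable : ∀ {n} → Graph n → ℕ → Set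
ProperlyConnectable G k = Σ (EdgeColoring G k) ProperlyConnected

-- pc[ G ]≡ k says that the minimum defining pc(G) is k.  When G has at most
-- one vertex this holds for k = 0 only.

pc[_]≡_ : ∀ {n} → Graph n → ℕ → Set
pc[ G ]≡ k = ProperlyConnectable G k × (∀ {j} → j < k → ¬ ProperlyConnectable G j)

ConnectedWithPc2 : ∀ {n} → Graph n → Set
ConnectedWithPc2 G = Connected G × (pc[ G ]≡ 2)

-- Two graphs on Fin n are the same labeled graph when they have the same
-- adjacencies; without function extensionality this is weaker than _≡_.

graphSetoid : ℕ → Setoid 0ℓ 0ℓ
graphSetoid n = record
  { Carrier       = Graph n
  ; _≈_           = λ G H → ∀ u v → adj G u v ≡ adj H u v
  ; isEquivalence = record
    { refl  = λ _ _ → refl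
    ; sym   = λ p u v → sym (p u v)
    ; trans = λ p q u v → trans (p u v) (q u v)
    }
  }

emptyGraph : Graph 0
emptyGraph = record { adj = λ () ; Adj-sym = λ { {()} } ; Adj-irrefl = λ { {()} } }

-- A new vertex zero with neighborhood S is added; the vertices of G are
-- shifted by suc.

extend : ∀ {n} → Subset n → Graph n → Graph (suc n)
extend {n} S G = record { adj = a ; Adj-sym = λ {u} {v} → s u v ; Adj-irrefl = λ { {u} refl → i u } }
  where
  a : Fin (suc n) → Fin (suc n) → Bool
  a zero    zero    = false
  a zero    (suc v) = lookup S v
  a (suc u) zero    = lookup S u
  a (suc u) (suc v) = adj G u v

  s : ∀ u v → T (a u v) → T (a v u)
  s zero    (suc v) e = e
  s (suc u) zero    e = e
  s (suc u) (suc v) e = Adj-sym G e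

  i : ∀ u → ¬ T (a u u)
  i (suc u) e = Adj-irrefl G refl e

allSubsets : ∀ n → List (Subset n)
allSubsets zero    = [ [] ]
allSubsets (suc n) = map (true ∷_) (allSubsets n) ++ map (false ∷_) (allSubsets n)

allGraphs : ∀ n → List (Graph n)
allGraphs zero    = [ emptyGraph ]
allGraphs (suc n) = cartesianProductWith extend (allSubsets n) (allGraphs n)

-- Every labeled graph occurs in allGraphs exactly once (allGraphs-complete
-- and allGraphs-unique).

allSubsets-complete : ∀ {n} (S : Subset n) → S ∈ₚ.∈ allSubsets n
allSubsets-complete []          = here refl
allSubsets-complete (true  ∷ S) = ∈-++⁺ˡ (∈-map⁺ _ (allSubsets-complete S))
allSubsets-complete (false ∷ S) =
  ∈-++⁺ʳ (map (true ∷_) (allSubsets _)) (∈-map⁺ _ (allSubsets-complete S))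

allSubsets-unique : ∀ n → Unique (allSubsets n)
allSubsets-unique zero    = [] ∷ []
allSubsets-unique (suc n) = Uniqueₚ.++⁺
  (Uniqueₚ.map⁺ (proj₂ ∘ ∷-injective) (allSubsets-unique n))
  (Uniqueₚ.map⁺ (proj₂ ∘ ∷-injective) (allSubsets-unique n))
  λ (p , q) → disjoint (∈-map⁻ _ p) (∈-map⁻ _ q)
  where
  disjoint : ∀ {S : Subset (suc n)} →
             ∃[ P ] (P ∈ₚ.∈ allSubsets n × S ≡ true ∷ P) →
             ¬ (∃[ Q ] (Q ∈ₚ.∈ allSubsets n × S ≡ false ∷ Q))
  disjoint (_ , _ , refl) (_ , _ , ())

module _ {n : ℕ} where
  open Setoid (graphSetoid n) public using () renaming (_≈_ to _≈ᴳ_)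

T-false : ∀ {b} → ¬ T b → b ≡ false
T-false {false} _ = refl
T-false {true}  p = ⊥-elim (p _)

T-injective : ∀ {a b} → (T a → T b) → (T b → T a) → a ≡ b
T-injective {false} {false} _ _ = refl
T-injective {false} {true}  _ g = ⊥-elim (g _)
T-injective {true}  {false} f _ = ⊥-elim (f _)
T-injective {true}  {true}  _ _ = refl

adj-sym : ∀ {n} (G : Graph n) u v → adj G u v ≡ adj G v u
adj-sym G u v = T-injective (Adj-sym G) (Adj-sym G)

extend-cong : ∀ {n} {S S′ : Subset n} {G G′ : Graph n} →
              S ≡ S′ → G ≈ᴳ G′ → extend S G ≈ᴳ extend S′ G′
extend-cong refl p zero    zero    = refl
extend-cong refl p zero    (suc v) = refl
extend-cong refl p (suc u) zero    = refl
extend-cong refl p (suc u) (suc v) = p u v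

extend-injective : ∀ {n} {S S′ : Subset n} {G G′ : Graph n} →
                   extend S G ≈ᴳ extend S′ G′ → S ≡ S′ × G ≈ᴳ G′
extend-injective {S = S} {S′} p =
  trans (sym (tabulate∘lookup S))
        (trans (tabulate-cong (p zero ∘ suc)) (tabulate∘lookup S′)) ,
  λ u v → p (suc u) (suc v)

neighborsOfZero : ∀ {n} → Graph (suc n) → Subset n
neighborsOfZero G = tabulate (adj G zero ∘ suc)

deleteZero : ∀ {n} → Graph (suc n) → Graph n
deleteZero G = record
  { adj        = λ u v → adj G (suc u) (suc v)
  ; Adj-sym    = Adj-sym G
  ; Adj-irrefl = λ { refl → Adj-irrefl G refl }
  }

extend-surjective : ∀ {n} (G : Graph (suc n)) →
                    G ≈ᴳ extend (neighborsOfZero G) (deleteZero G)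
extend-surjective G zero    zero    = T-false (Adj-irrefl G refl)
extend-surjective G zero    (suc v) = sym (lookup∘tabulate _ v)
extend-surjective G (suc u) zero    =
  trans (adj-sym G (suc u) zero) (sym (lookup∘tabulate _ u))
extend-surjective G (suc u) (suc v) = refl

allGraphs-complete : ∀ {n} (G : Graph n) → ∈ₛ._∈_ (graphSetoid n) G (allGraphs n)
allGraphs-complete {zero}  G = here λ ()
allGraphs-complete {suc n} G =
  ∈ₛₚ.∈-resp-≈ (graphSetoid (suc n))
    {x = extend (neighborsOfZero G) (deleteZero G)} {y = G}
    (Setoid.sym (graphSetoid (suc n)) {x = G} {y = extend (neighborsOfZero G) (deleteZero G)}
      (extend-surjective G))
    (∈ₛₚ.∈-cartesianProductWith⁺ (setoid (Subset n)) (graphSetoid n) (graphSetoid (suc n))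
      (λ {S} {S′} {G} {G′} → extend-cong {S = S} {S′} {G} {G′})
      (allSubsets-complete (neighborsOfZero G))
      (allGraphs-complete (deleteZero G)))

allGraphs-unique : ∀ n → Uniqueₛ.Unique (graphSetoid n) (allGraphs n)
allGraphs-unique zero    = [] ∷ []
allGraphs-unique (suc n) =
  Uniqueₛₚ.cartesianProductWith⁺ (setoid (Subset n)) (graphSetoid n) (graphSetoid (suc n))
    extend (λ {S} {S′} {G} {G′} → extend-injective {S = S} {S′} {G} {G′})
    (allSubsets-unique n) (allGraphs-unique n)

lookup-injective : ∀ {A : Set} {xs : List A} → Unique xs →
                   ∀ {i j} → List.lookup xs i ≡ List.lookup xs j → i ≡ j
lookup-injective {xs = _ ∷ _}  _         {zero}  {zero}  _  = refl
lookup-injective {xs = _ ∷ xs} (px ∷ _)  {zero}  {suc j} eq =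
  contradiction eq (All.lookup px (∈-lookup j))
lookup-injective {xs = _ ∷ xs} (px ∷ _)  {suc i} {zero}  eq =
  contradiction (sym eq) (All.lookup px (∈-lookup i))
lookup-injective {xs = _ ∷ _}  (_ ∷ pxs) {suc i} {suc j} eq =
  cong suc (lookup-injective pxs eq)

unique⇒length≤ : ∀ {n} {xs : List (Fin n)} → Unique xs → length xs ≤ n
unique⇒length≤ p = injective⇒≤ (lookup-injective p)

T-dec : ∀ b {P : T b → Set} → Decidable P → Dec (∃ P)
T-dec true  P? = map′ (λ p → _ , p) proj₂ (P? _)
T-dec false P? = no λ ()

allT? : ∀ b {P : T b → Set} → Decidable P → Dec (∀ e → P e)
allT? true  P? = map′ (λ p _ → p) (λ f → f _) (P? _)
allT? false P? = yes λ ()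

module _ {n} (G : Graph n) where

  boundedWalk? : ∀ m {u v} {P : Walk G u v → Set} → Decidable P →
                 Dec (∃[ w ] (length (vertices G w) ≤ m × P w))
  boundedWalk? zero    P? = no λ { (ε , () , _) ; (_ ◅ _ , () , _) }
  boundedWalk? (suc m) {u} {v} P? with u Fin.≟ v
  boundedWalk? (suc m) {u} {u} P? | yes refl with P? ε
  ... | yes p = yes (ε , s≤s z≤n , p)
  ... | no ¬p = map′
    (λ { (x , e , w , l , p) → e ◅ w , s≤s l , p })
    (λ { (ε , _ , p) → contradiction p ¬p ; (e ◅ w , s≤s l , p) → _ , e , w , l , p })
    (any? λ x → T-dec (adj G u x) λ e → boundedWalk? m (P? ∘ (e ◅_)))
  boundedWalk? (suc m) {u} {v} P? | no u≢v = map′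
    (λ { (x , e , w , l , p) → e ◅ w , s≤s l , p })
    (λ { (ε , _ , _) → contradiction refl u≢v ; (e ◅ w , s≤s l , p) → _ , e , w , l , p })
    (any? λ x → T-dec (adj G u x) λ e → boundedWalk? m (P? ∘ (e ◅_)))

  isPath? : ∀ {u v} → Decidable (IsPath G {u} {v})
  isPath? w = allPairs? (λ x y → ¬? (x Fin.≟ y)) (vertices G w)

  path? : ∀ {u v} {P : Walk G u v → Set} → (∀ {w} → P w → IsPath G w) →
          Decidable P → Dec (∃ P)
  path? P⇒path P? = map′
    (λ { (w , _ , p) → w , p })
    (λ { (w , p) → w , unique⇒length≤ (P⇒path p) , p })
    (boundedWalk? n P?)

  connected? : Dec (Connected G)
  connected? = all? λ u → all? λ v → path? (λ p → p) isPath?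

properlyConnected? : ∀ {n} {G : Graph n} {k} (c : EdgeColoring G k) →
                     Dec (ProperlyConnected c)
properlyConnected? {G = G} c =
  all? λ u → all? λ v → ¬? (u Fin.≟ v) →-dec
    path? G proj₁ λ w → isPath? G w ×-dec linked? (λ x y → ¬? (x Fin.≟ y)) (colors c w)

-- Exhaustive search, for predicates that respect pointwise equality.

Searchable : (A : Set) → Rel A 0ℓ → Set₁
Searchable A _≈_ = ∀ {P : Pred A 0ℓ} → P Respects _≈_ → Decidable P → Dec (∃ P)

Πcons : ∀ {n} {A : Fin (suc n) → Set} → A zero → (∀ i → A (suc i)) → ∀ i → A i
Πcons a f zero    = a
Πcons a f (suc i) = f i

Π-searchable : ∀ n {A : Fin n → Set} {R : ∀ i → Rel (A i) 0ℓ} →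
               (∀ i → Reflexive (R i)) → (∀ i → Searchable (A i) (R i)) →
               Searchable (∀ i → A i) (λ f g → ∀ i → R i (f i) (g i))
Π-searchable zero    rfl s resp P? =
  map′ (λ p → _ , p) (λ { (f , p) → resp (λ ()) p }) (P? λ ())
Π-searchable (suc n) {A} {R} rfl s {P} resp P? = map′
  (λ { (a , f , p) → Πcons a f , p })
  (λ { (f , p) → f zero , f ∘ suc , resp (λ { zero → rfl _ ; (suc _) → rfl _ }) p })
  (s zero
    (λ { q (f , p) → f , resp (λ { zero → q ; (suc _) → rfl _ }) p })
    λ a → Π-searchable n (rfl ∘ suc) (s ∘ suc)
      (λ q → resp (λ { zero → rfl _ ; (suc i) → q i }))
      (P? ∘ Πcons a))

T→Fin-searchable : ∀ b k → Searchable (T b → Fin k) (λ f g → ∀ e → f e ≡ g e)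
T→Fin-searchable true  k resp P? =
  map′ (λ { (x , p) → _ , p }) (λ { (f , p) → f _ , resp (λ _ → refl) p })
    (any? λ x → P? λ _ → x)
T→Fin-searchable false k resp P? =
  map′ (λ p → _ , p) (λ { (f , p) → resp (λ ()) p }) (P? λ ())

properlyConnectable? : ∀ {n} (G : Graph n) k → Dec (ProperlyConnectable G k)
properlyConnectable? {n} G k = map′
  (λ { (c , s , p) → record { color = c ; color-sym = s } , p })
  (λ { (c , p) → color c , color-sym c , p })
  (Π-searchable n (λ _ _ _ → refl)
    (λ u → Π-searchable n (λ _ _ → refl) λ v → T→Fin-searchable (adj G u v) k)
    (λ {c} {c′} → respects {c} {c′}) decide)
  where
  Color : Set
  Color = ∀ u v → Adj G u v → Fin k

  Sym : Color → Set
  Sym c = ∀ u v (e : Adj G u v) → c v u (Adj-sym G e) ≡ c u v e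

  coloring : (c : Color) → Sym c → EdgeColoring G k
  coloring c s = record { color = c ; color-sym = s }

  Good : Color → Set
  Good c = Σ (Sym c) λ s → ProperlyConnected (coloring c s)

  colors-cong : ∀ {c c′ s s′} → (∀ u v e → c u v e ≡ c′ u v e) →
                ∀ {u v} (w : Walk G u v) → colors (coloring c s) w ≡ colors (coloring c′ s′) w
  colors-cong q ε       = refl
  colors-cong {s = s} {s′} q (e ◅ w) =
    cong₂ _∷_ (q _ _ e) (colors-cong {s = s} {s′} q w)

  transport : ∀ {c c′ s s′} → (∀ u v e → c u v e ≡ c′ u v e) →
              ProperlyConnected (coloring c s) → ProperlyConnected (coloring c′ s′)
  transport {s = s} {s′} q p u v u≢v with p u v u≢v
  ... | w , d , l = w , d , subst (Linked _≢_) (colors-cong {s = s} {s′} q w) l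

  respects : Good Respects (λ c c′ → ∀ u v e → c u v e ≡ c′ u v e)
  respects q (s , p) =
    (λ u v e → trans (sym (q _ _ _)) (trans (s u v e) (q _ _ _))) , transport {s = s} q p

  decide : Decidable Good
  decide c with all? (λ u → all? λ v → allT? (adj G u v) λ e → c v u (Adj-sym G e) Fin.≟ c u v e)
  ... | no ¬s = no (¬s ∘ proj₁)
  ... | yes s = map′ (s ,_) (λ { (_ , p) → transport {s′ = s} (λ _ _ _ → refl) p })
                  (properlyConnected? (coloring c s))

pc? : ∀ {n} (G : Graph n) k → Dec (pc[ G ]≡ k)
pc? G k = properlyConnectable? G k ×-dec allUpTo? (λ j → ¬? (properlyConnectable? G j)) k

connectedWithPc2? : ∀ {n} → Decidable (ConnectedWithPc2 {n})
connectedWithPc2? G = connected? G ×-dec pc? G 2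

countGraphs : ∀ n {P : Graph n → Set} → Decidable P → ℕ
countGraphs n P? = length (filter P? (allGraphs n))

proportion : (P : ∀ {n} → Graph n → Set) → (∀ {n} → Decidable (P {n})) → ℕ → ℚ
proportion P P? n = (+ countGraphs n P?) ℚ./ (2 ^ (n C 2))
  where instance
    2^≢0 : NonZero (2 ^ (n C 2))
    2^≢0 = m^n≢0 2 (n C 2)

-- All terms are rational, so rational ε give the usual real limit.

_TendsTo_ : (ℕ → ℚ) → ℚ → Set
s TendsTo ℓ = ∀ ε → 0ℚ ℚ.< ε → ∃[ N ] ∀ n → N ≤ n → ℚ.∣ s n ℚ.- ℓ ∣ ℚ.< ε

AlmostAll : (P : ∀ {n} → Graph n → Set) → (∀ {n} → Decidable (P {n})) → Set
AlmostAll P P? = proportion P P? TendsTo 1ℚ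

{-# OPTIONS --safe #-}
module Submission where

-- Split the vertices into two classes by the parity of their index and color
-- an edge by whether it joins different classes.  A path u – b – b′ – v is
-- then proper as soon as b avoids the class of v and b′ avoids the class
-- of u.  Each block of four consecutive vertices provides such a pair (b, b′)
-- in residues mod 4 different from those of u and v, so there are ⌊n/4⌋
-- candidate paths with pairwise disjoint edge sets.  Each is present with
-- probability 1/8, so all are absent with probability (7/8)^⌊n/4⌋, and a
-- union bound over u and v applies.  Hence pc(G) ≤ 2 for almost all G, while
-- pc(G) < 2 forces G to be complete.

open import Defs
open import Data.Bool.Base using (Bool; true; false; not; _∧_; _xor_; if_then_else_)
open import Data.Bool.Properties as Boolₚ using (T-≡; T-∧; xor-comm)
open import Data.Fin.Base using (Fin; zero; suc; toℕ; combine; inject≤)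
open import Data.Fin.Properties as Finₚ
  using (any?; all?; toℕ-injective; toℕ-fromℕ<; toℕ-inject≤; toℕ-combine; toℕ<n;
         inject≤-injective; combine-injectiveˡ)
open import Data.Fin.Subset using (Subset)
import Data.Integer.Base as ℤ
import Data.Integer.Properties as ℤₚ
open import Data.List.Base
  using (List; []; _∷_; length; map; _++_; filter; cartesianProductWith; allFin; tabulate)
open import Data.List.Properties using (length-tabulate)
open import Data.List.Relation.Unary.All using ([]; _∷_)
open import Data.List.Relation.Unary.AllPairs using ([]; _∷_)
open import Data.List.Relation.Unary.Linked using ([-]; _∷_)
open import Data.Nat.Base
open import Data.Nat.Combinatorics using (_C_; nC1≡n; nCk+nC[k+1]≡[n+1]C[k+1])
open import Data.Nat.DivMod
open import Data.Nat.ListAction using (sum)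
open import Data.Nat.Properties
open import Data.Nat.Tactic.RingSolver using (solve-∀)
open import Data.Product.Base using (∃-syntax; ∃₂; _×_; _,_; proj₁; proj₂)
open import Data.Rational.Base as ℚ using (ℚ; mkℚ; 0ℚ; 1ℚ; toℚᵘ)
import Data.Rational.Properties as ℚₚ
open import Data.Rational.Unnormalised.Base as ℚᵘ using (mkℚᵘ)
import Data.Rational.Unnormalised.Properties as ℚᵘₚ
open import Data.Vec.Base using ([]; _∷_; lookup)
import Data.Vec.Functional as Vector
open import Function.Base using (_∘_)
open import Function.Bundles using (Equivalence)
open import Relation.Binary.Construct.Closure.ReflexiveTransitive using (ε; _◅_)
open import Relation.Binary.PropositionalEquality
open import Relation.Nullary.Decidable using (Dec; yes; no; does; ¬?; _×-dec_; from-yes)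
open import Relation.Nullary.Negation using (contradiction)
open import Relation.Unary using (Decidable)

open Graph using (adj; Adj; Connected)
open EdgeColoring using (IsProperPath; ProperlyConnected)

private variable
  A B : Set
  m n : ℕ

-- Finite sums over lists.

∑ : List A → (A → ℕ) → ℕ
∑ xs f = sum (map f xs)

syntax ∑ xs (λ x → e) = ∑[ x ∈ xs ] e
infix 5 ∑

∑-cong : ∀ (xs : List A) {f g : A → ℕ} → (∀ x → f x ≡ g x) → ∑ xs f ≡ ∑ xs g
∑-cong []       eq = refl
∑-cong (x ∷ xs) eq = cong₂ _+_ (eq x) (∑-cong xs eq)

∑-mono-≤ : ∀ (xs : List A) {f g : A → ℕ} → (∀ x → f x ≤ g x) → ∑ xs f ≤ ∑ xs g
∑-mono-≤ []       le = z≤n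
∑-mono-≤ (x ∷ xs) le = +-mono-≤ (le x) (∑-mono-≤ xs le)

∑-++ : ∀ (xs ys : List A) (f : A → ℕ) → ∑ (xs ++ ys) f ≡ ∑ xs f + ∑ ys f
∑-++ []       ys f = refl
∑-++ (x ∷ xs) ys f = trans (cong (f x +_) (∑-++ xs ys f)) (sym (+-assoc (f x) _ _))

∑-map : ∀ (h : A → B) (xs : List A) (f : B → ℕ) → ∑ (map h xs) f ≡ ∑ xs (f ∘ h)
∑-map h []       f = refl
∑-map h (x ∷ xs) f = cong (f (h x) +_) (∑-map h xs f)

∑-distrib-+ : ∀ (xs : List A) (f g : A → ℕ) → (∑[ x ∈ xs ] (f x + g x)) ≡ ∑ xs f + ∑ xs g
∑-distrib-+ []       f g = refl
∑-distrib-+ (x ∷ xs) f g =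
  trans (cong (f x + g x +_) (∑-distrib-+ xs f g)) (interchange (f x) (g x) _ _)
  where
  interchange : ∀ a b c d → a + b + (c + d) ≡ a + c + (b + d)
  interchange = solve-∀

*-distribˡ-∑ : ∀ c (xs : List A) (f : A → ℕ) → c * ∑ xs f ≡ ∑[ x ∈ xs ] (c * f x)
*-distribˡ-∑ c []       f = *-zeroʳ c
*-distribˡ-∑ c (x ∷ xs) f =
  trans (*-distribˡ-+ c (f x) _) (cong (c * f x +_) (*-distribˡ-∑ c xs f))

∑-const : ∀ (xs : List A) c → (∑[ x ∈ xs ] c) ≡ length xs * c
∑-const []       c = refl
∑-const (x ∷ xs) c = cong (c +_) (∑-const xs c)

∑-comm : ∀ (xs : List A) (ys : List B) (f : A → B → ℕ) →
         (∑[ x ∈ xs ] ∑[ y ∈ ys ] f x y) ≡ (∑[ y ∈ ys ] ∑[ x ∈ xs ] f x y)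
∑-comm []       ys f = sym (trans (∑-const ys 0) (*-zeroʳ (length ys)))
∑-comm (x ∷ xs) ys f =
  trans (cong (∑ ys (f x) +_) (∑-comm xs ys f)) (sym (∑-distrib-+ ys (f x) _))

∑-cartesianProductWith : ∀ {C : Set} (h : A → B → C) xs ys (f : C → ℕ) →
  ∑ (cartesianProductWith h xs ys) f ≡ (∑[ x ∈ xs ] ∑[ y ∈ ys ] f (h x y))
∑-cartesianProductWith h []       ys f = refl
∑-cartesianProductWith h (x ∷ xs) ys f =
  trans (∑-++ (map (h x) ys) _ f)
        (cong₂ _+_ (∑-map (h x) ys f) (∑-cartesianProductWith h xs ys f))

∑-tabulate≡0 : ∀ {n} (h : Fin n → A) (f : A → ℕ) →
               ∑ (tabulate h) f ≡ 0 → ∀ i → f (h i) ≡ 0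
∑-tabulate≡0 h f eq zero    = m+n≡0⇒m≡0 (f (h zero)) eq
∑-tabulate≡0 h f eq (suc i) = ∑-tabulate≡0 (h ∘ suc) f (m+n≡0⇒n≡0 (f (h zero)) eq) i

-- Indicators and finite conjunctions.

𝟙 : Bool → ℕ
𝟙 b = if b then 1 else 0

𝟙-∧ : ∀ a b → 𝟙 (a ∧ b) ≡ 𝟙 a * 𝟙 b
𝟙-∧ true  b = sym (+-identityʳ (𝟙 b))
𝟙-∧ false b = refl

𝟙-not : ∀ b → 𝟙 b + 𝟙 (not b) ≡ 1
𝟙-not true  = refl
𝟙-not false = refl

length-filter : ∀ {P : A → Set} (P? : Decidable P) xs →
                length (filter P? xs) ≡ ∑[ x ∈ xs ] 𝟙 (does (P? x))
length-filter P? []       = refl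
length-filter P? (x ∷ xs) with does (P? x)
... | true  = cong suc (length-filter P? xs)
... | false = length-filter P? xs

⋀ : (Fin n → Bool) → Bool
⋀ = Vector.foldr _∧_ true

⋀-cong : ∀ {n} {f g : Fin n → Bool} → (∀ i → f i ≡ g i) → ⋀ f ≡ ⋀ g
⋀-cong {zero}  eq = refl
⋀-cong {suc n} eq = cong₂ _∧_ (eq zero) (⋀-cong (eq ∘ suc))

⋀-true : ∀ {n} {f : Fin n → Bool} → (∀ i → f i ≡ true) → ⋀ f ≡ true
⋀-true {zero}  p = refl
⋀-true {suc n} p = cong₂ _∧_ (p zero) (⋀-true (p ∘ suc))

⋀-false : ∀ {n} {f : Fin n → Bool} → ⋀ f ≡ false → ∃[ i ] f i ≡ false
⋀-false {suc n} {f} p with f zero in eq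
... | false = zero , eq
... | true  with i , q ← ⋀-false {n} {f ∘ suc} p = suc i , q

-- Sums over all subsets and all labeled graphs.

∑-allSubsets : ∀ n (f : Subset (suc n) → ℕ) →
  ∑ (allSubsets (suc n)) f ≡ ∑ (allSubsets n) (f ∘ (true ∷_)) + ∑ (allSubsets n) (f ∘ (false ∷_))
∑-allSubsets n f = trans (∑-++ (map (true ∷_) (allSubsets n)) _ f)
  (cong₂ _+_ (∑-map (true ∷_) (allSubsets n) f) (∑-map (false ∷_) (allSubsets n) f))

∑-allGraphs : ∀ n (f : Graph (suc n) → ℕ) →
  ∑ (allGraphs (suc n)) f ≡ (∑[ S ∈ allSubsets n ] ∑[ G ∈ allGraphs n ] f (extend S G))
∑-allGraphs n f = ∑-cartesianProductWith extend (allSubsets n) (allGraphs n) f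

∑-allSubsets-1 : ∀ n → (∑[ S ∈ allSubsets n ] 1) ≡ 2 ^ n
∑-allSubsets-1 zero    = refl
∑-allSubsets-1 (suc n) = trans (∑-allSubsets n (λ _ → 1))
  (cong₂ _+_ (∑-allSubsets-1 n) (trans (∑-allSubsets-1 n) (sym (+-identityʳ (2 ^ n)))))

-- Pascal's rule: a new vertex brings `n` new potential edges.
sucC2 : ∀ n → 2 ^ (suc n C 2) ≡ 2 ^ n * 2 ^ (n C 2)
sucC2 n = trans (cong (2 ^_) (sym (trans (cong (_+ n C 2) (sym (nC1≡n n))) (nCk+nC[k+1]≡[n+1]C[k+1] n 1))))
                (^-distribˡ-+-* 2 n (n C 2))

∑-allGraphs-1 : ∀ n → (∑[ G ∈ allGraphs n ] 1) ≡ 2 ^ (n C 2)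
∑-allGraphs-1 zero    = refl
∑-allGraphs-1 (suc n) = begin
  (∑[ G ∈ allGraphs (suc n) ] 1)
    ≡⟨ ∑-allGraphs n (λ _ → 1) ⟩
  (∑[ S ∈ allSubsets n ] ∑[ G ∈ allGraphs n ] 1)
    ≡⟨ ∑-cong (allSubsets n) (λ _ → trans (∑-allGraphs-1 n) (sym (*-identityʳ _))) ⟩
  (∑[ S ∈ allSubsets n ] (2 ^ (n C 2) * 1))
    ≡⟨ *-distribˡ-∑ (2 ^ (n C 2)) (allSubsets n) (λ _ → 1) ⟨
  2 ^ (n C 2) * (∑[ S ∈ allSubsets n ] 1)
    ≡⟨ cong (2 ^ (n C 2) *_) (∑-allSubsets-1 n) ⟩
  2 ^ (n C 2) * 2 ^ n
    ≡⟨ *-comm (2 ^ (n C 2)) (2 ^ n) ⟩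
  2 ^ n * 2 ^ (n C 2)
    ≡⟨ sucC2 n ⟨
  2 ^ (suc n C 2) ∎
  where open ≡-Reasoning

∑-full : ∀ n → (∑[ S ∈ allSubsets n ] 𝟙 (⋀ (lookup S))) ≡ 1
∑-full zero    = refl
∑-full (suc n) = trans (∑-allSubsets n (λ S → 𝟙 (⋀ (lookup S))))
  (cong₂ _+_ (∑-full n) (trans (∑-const (allSubsets n) 0) (*-zeroʳ (length (allSubsets n)))))

-- A complete graph has this property, so its failure rules out completeness. It involves only the
-- neighborhood of one vertex, which makes it easy to count.
dominates : Graph (suc n) → Bool
dominates G = ⋀ (λ v → adj G zero (suc v))

-- The neighborhood of vertex zero is forced to be full, while the graph on the other `n` vertices
-- stays free.
∑-dominates : ∀ n → (∑[ G ∈ allGraphs (suc n) ] 𝟙 (dominates G)) ≡ 2 ^ (n C 2)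
∑-dominates n = begin
  (∑[ G ∈ allGraphs (suc n) ] 𝟙 (dominates G))
    ≡⟨ ∑-allGraphs n (𝟙 ∘ dominates) ⟩
  (∑[ S ∈ allSubsets n ] ∑[ G ∈ allGraphs n ] 𝟙 (⋀ (lookup S)))
    ≡⟨ ∑-comm (allSubsets n) (allGraphs n) _ ⟩
  (∑[ G ∈ allGraphs n ] ∑[ S ∈ allSubsets n ] 𝟙 (⋀ (lookup S)))
    ≡⟨ ∑-cong (allGraphs n) (λ _ → ∑-full n) ⟩
  (∑[ G ∈ allGraphs n ] 1)
    ≡⟨ ∑-allGraphs-1 n ⟩
  2 ^ (n C 2) ∎
  where open ≡-Reasoning

-- Independence of a single edge.

AgreeOff₁ : Fin n → Subset n → Subset n → Set
AgreeOff₁ v S S′ = ∀ w → w ≢ v → lookup S w ≡ lookup S′ w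

-- Inserting or removing `v` pairs the subsets with and without `v`, and `f` is constant on each
-- pair, so those with `v` carry half of the sum.
∑-half-subset : ∀ {n} v (f : Subset n → ℕ) → (∀ {S S′} → AgreeOff₁ v S S′ → f S ≡ f S′) →
  2 * (∑[ S ∈ allSubsets n ] (f S * 𝟙 (lookup S v))) ≡ ∑ (allSubsets n) f
∑-half-subset {suc n} zero f ind = begin
  2 * (∑[ S ∈ allSubsets (suc n) ] (f S * 𝟙 (lookup S zero)))
    ≡⟨ cong (2 *_) (∑-allSubsets n _) ⟩
  2 * ((∑[ S ∈ allSubsets n ] (f (true ∷ S) * 1)) + (∑[ S ∈ allSubsets n ] (f (false ∷ S) * 0)))
    ≡⟨ cong (2 *_) (cong₂ _+_ (∑-cong (allSubsets n) (λ S → *-identityʳ (f (true ∷ S))))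
         (trans (∑-cong (allSubsets n) (λ S → *-zeroʳ (f (false ∷ S))))
                (trans (∑-const (allSubsets n) 0) (*-zeroʳ (length (allSubsets n)))))) ⟩
  2 * (X + 0)
    ≡⟨ double X ⟩
  X + X
    ≡⟨ cong (X +_) (∑-cong (allSubsets n) (λ S → ind (λ { zero q → contradiction refl q ; (suc _) _ → refl }))) ⟩
  X + (∑[ S ∈ allSubsets n ] f (false ∷ S))
    ≡⟨ ∑-allSubsets n f ⟨
  ∑ (allSubsets (suc n)) f ∎
  where
  open ≡-Reasoning
  X = ∑[ S ∈ allSubsets n ] f (true ∷ S)
  double : ∀ x → 2 * (x + 0) ≡ x + x
  double = solve-∀
∑-half-subset {suc n} (suc v) f ind = begin
  2 * (∑[ S ∈ allSubsets (suc n) ] (f S * 𝟙 (lookup S (suc v))))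
    ≡⟨ cong (2 *_) (∑-allSubsets n _) ⟩
  2 * (∑ (allSubsets n) (λ S → f (true ∷ S) * 𝟙 (lookup S v)) + ∑ (allSubsets n) (λ S → f (false ∷ S) * 𝟙 (lookup S v)))
    ≡⟨ *-distribˡ-+ 2 (∑ (allSubsets n) _) _ ⟩
  2 * ∑ (allSubsets n) (λ S → f (true ∷ S) * 𝟙 (lookup S v)) + 2 * ∑ (allSubsets n) (λ S → f (false ∷ S) * 𝟙 (lookup S v))
    ≡⟨ cong₂ _+_ (∑-half-subset v (f ∘ (true ∷_)) (ind ∘ cons)) (∑-half-subset v (f ∘ (false ∷_)) (ind ∘ cons)) ⟩
  ∑ (allSubsets n) (f ∘ (true ∷_)) + ∑ (allSubsets n) (f ∘ (false ∷_))
    ≡⟨ ∑-allSubsets n f ⟨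
  ∑ (allSubsets (suc n)) f ∎
  where
  open ≡-Reasoning
  cons : ∀ {b S S′} → AgreeOff₁ v S S′ → AgreeOff₁ (suc v) (b ∷ S) (b ∷ S′)
  cons a zero    _ = refl
  cons a (suc w) q = a w (q ∘ cong suc)

-- By symmetry and irreflexivity, G and H can then differ only in the edge xy.

AgreeOff : Fin n → Fin n → Graph n → Graph n → Set
AgreeOff x y G H = ∀ p → p ≢ x → p ≢ y → ∀ q → adj G p q ≡ adj H p q

-- Exchanging the sums fixes the graph on the old vertices. Only the neighborhood of zero then
-- varies, and `∑-half-subset` applies to it.
∑-half-zero : ∀ {n} v (f : Graph (suc n) → ℕ) →
  (∀ {G H} → AgreeOff zero (suc v) G H → f G ≡ f H) →
  2 * (∑[ S ∈ allSubsets n ] ∑[ G ∈ allGraphs n ] (f (extend S G) * 𝟙 (lookup S v))) ≡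
  ∑ (allGraphs (suc n)) f
∑-half-zero {n} v f ind = begin
  2 * (∑[ S ∈ allSubsets n ] ∑[ G ∈ allGraphs n ] (f (extend S G) * 𝟙 (lookup S v)))
    ≡⟨ cong (2 *_) (∑-comm (allSubsets n) (allGraphs n) _) ⟩
  2 * (∑[ G ∈ allGraphs n ] ∑[ S ∈ allSubsets n ] (f (extend S G) * 𝟙 (lookup S v)))
    ≡⟨ *-distribˡ-∑ 2 (allGraphs n) _ ⟩
  (∑[ G ∈ allGraphs n ] (2 * (∑[ S ∈ allSubsets n ] (f (extend S G) * 𝟙 (lookup S v)))))
    ≡⟨ ∑-cong (allGraphs n) (λ G → ∑-half-subset v (λ S → f (extend S G)) (λ a → ind (off a))) ⟩
  (∑[ G ∈ allGraphs n ] ∑[ S ∈ allSubsets n ] f (extend S G))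
    ≡⟨ ∑-comm (allGraphs n) (allSubsets n) _ ⟩
  (∑[ S ∈ allSubsets n ] ∑[ G ∈ allGraphs n ] f (extend S G))
    ≡⟨ ∑-allGraphs n f ⟨
  ∑ (allGraphs (suc n)) f ∎
  where
  open ≡-Reasoning
  off : ∀ {S S′ G} → AgreeOff₁ v S S′ → AgreeOff zero (suc v) (extend S G) (extend S′ G)
  off a zero    p≢0 _   _       = contradiction refl p≢0
  off a (suc p) _   p≢v zero    = a p (p≢v ∘ cong suc)
  off a (suc p) _   _   (suc q) = refl

-- In probabilistic terms, the edge `x y` is a fair coin independent of `f`. Vertex zero is peeled
-- off until it is an endpoint of the edge, where `∑-half-zero` takes over.
∑-half : ∀ {n} x y → x ≢ y → (f : Graph n → ℕ) → (∀ {G H} → AgreeOff x y G H → f G ≡ f H) →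
  2 * (∑[ G ∈ allGraphs n ] (f G * 𝟙 (adj G x y))) ≡ ∑ (allGraphs n) f
∑-half zero    zero    x≢y f ind = contradiction refl x≢y
∑-half {suc n} zero    (suc v) _ f ind = trans (cong (2 *_) (∑-allGraphs n _)) (∑-half-zero v f ind)
∑-half {suc n} (suc v) zero    _ f ind = trans (cong (2 *_) (∑-allGraphs n _))
  (∑-half-zero v f λ a → ind λ p p≢v p≢0 → a p p≢0 p≢v)
∑-half {suc n} (suc x) (suc y) x≢y f ind = begin
  2 * (∑[ G ∈ allGraphs (suc n) ] (f G * 𝟙 (adj G (suc x) (suc y))))
    ≡⟨ cong (2 *_) (∑-allGraphs n _) ⟩
  2 * (∑[ S ∈ allSubsets n ] ∑[ G ∈ allGraphs n ] (f (extend S G) * 𝟙 (adj G x y)))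
    ≡⟨ *-distribˡ-∑ 2 (allSubsets n) _ ⟩
  (∑[ S ∈ allSubsets n ] (2 * (∑[ G ∈ allGraphs n ] (f (extend S G) * 𝟙 (adj G x y)))))
    ≡⟨ ∑-cong (allSubsets n) (λ S → ∑-half x y (x≢y ∘ cong suc) (f ∘ extend S) (λ a → ind (off S a))) ⟩
  (∑[ S ∈ allSubsets n ] ∑[ G ∈ allGraphs n ] f (extend S G))
    ≡⟨ ∑-allGraphs n f ⟨
  ∑ (allGraphs (suc n)) f ∎
  where
  open ≡-Reasoning
  off : ∀ S {G H} → AgreeOff x y G H → AgreeOff (suc x) (suc y) (extend S G) (extend S H)
  off S a zero    _   _   zero    = refl
  off S a zero    _   _   (suc q) = refl
  off S a (suc p) _   _   zero    = refl
  off S a (suc p) p≢x p≢y (suc q) = a p (p≢x ∘ cong suc) (p≢y ∘ cong suc) q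

-- Edge-disjoint candidate paths and the probability that all are absent.

bridge : Graph n → Fin n → Fin n → Fin n → Fin n → Bool
bridge G u v b b′ = (adj G b′ v ∧ adj G u b) ∧ adj G b b′

missed : Graph n → Fin n → Fin n → (Fin m → Fin n) → (Fin m → Fin n) → Bool
missed G u v b b′ = ⋀ λ j → not (bridge G u v (b j) (b′ j))

-- These conditions make bridges with different indices edge-disjoint. They allow `u` and `v` to
-- coincide, so that the union bound can run over all ordered pairs.
record Separated (u v : Fin n) (b b′ : Fin m → Fin n) : Set where
  field
    b-injective  : ∀ {i j} → b i ≡ b j → i ≡ j
    b′-injective : ∀ {i j} → b′ i ≡ b′ j → i ≡ j
    b≢b′         : ∀ i j → b i ≢ b′ j
    b≢u          : ∀ i → b i ≢ u
    b≢v          : ∀ i → b i ≢ v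
    b′≢u         : ∀ i → b′ i ≢ u
    b′≢v         : ∀ i → b′ i ≢ v

tail-separated : ∀ {u v : Fin n} {b b′ : Fin (suc m) → Fin n} →
                 Separated u v b b′ → Separated u v (b ∘ suc) (b′ ∘ suc)
tail-separated s = record
  { b-injective  = Finₚ.suc-injective ∘ b-injective
  ; b′-injective = Finₚ.suc-injective ∘ b′-injective
  ; b≢b′ = λ i j → b≢b′ (suc i) (suc j)
  ; b≢u  = b≢u ∘ suc
  ; b≢v  = b≢v ∘ suc
  ; b′≢u = b′≢u ∘ suc
  ; b′≢v = b′≢v ∘ suc
  }
  where open Separated s

-- `AgreeOff` speaks of rows of the adjacency matrix; symmetry carries it over to columns. This
-- serves edges whose first endpoint may be `x` or `y`.
agree-sym : ∀ {x y} (G H : Graph n) → AgreeOff x y G H →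
            ∀ q → q ≢ x → q ≢ y → ∀ p → adj G p q ≡ adj H p q
agree-sym G H a q q≢x q≢y p =
  trans (adj-sym G p q) (trans (a q q≢x q≢y p) (adj-sym H q p))

-- Induction on the number of bridges. The three edges of the first bridge occur in no later one, so
-- three uses of `∑-half` show that it is present in one eighth of the graphs that miss all later
-- bridges, and absent from the other seven eighths.
∑-missed : ∀ {n m} {u v : Fin n} {b b′ : Fin m → Fin n} → Separated u v b b′ →
           8 ^ m * (∑[ G ∈ allGraphs n ] 𝟙 (missed G u v b b′)) ≡ 7 ^ m * 2 ^ (n C 2)
∑-missed {n} {zero}  s = cong (1 *_) (∑-allGraphs-1 n)
∑-missed {n} {suc m} {u} {v} {b} {b′} s = begin
  8 * 8 ^ m * (∑[ G ∈ Gs ] 𝟙 (not (g G) ∧ rest G))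
    ≡⟨ cong (8 * 8 ^ m *_) (∑-cong Gs λ G → 𝟙-∧ (not (g G)) (rest G)) ⟩
  8 * 8 ^ m * X
    ≡⟨ rearrange 8 (8 ^ m) X ⟩
  8 ^ m * (8 * X)
    ≡⟨ cong (8 ^ m *_) 8X≡7S ⟩
  8 ^ m * (7 * S)
    ≡⟨ swap (8 ^ m) 7 S ⟩
  7 * (8 ^ m * S)
    ≡⟨ cong (7 *_) (∑-missed (tail-separated s)) ⟩
  7 * (7 ^ m * 2 ^ (n C 2))
    ≡⟨ *-assoc 7 (7 ^ m) _ ⟨
  7 * 7 ^ m * 2 ^ (n C 2) ∎
  where
  open ≡-Reasoning
  open Separated s
  Gs = allGraphs n
  b₀ = b zero
  b₀′ = b′ zero

  g rest : Graph n → Bool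
  g G = bridge G u v b₀ b₀′
  rest G = missed G u v (b ∘ suc) (b′ ∘ suc)

  -- Among the `S` graphs that miss all later bridges, `X` also miss the first one and `Y` contain
  -- it. `Y` is written as a product so that its edge factors can be removed one at a time.
  S = ∑[ G ∈ Gs ] 𝟙 (rest G)
  X = ∑[ G ∈ Gs ] (𝟙 (not (g G)) * 𝟙 (rest G))
  Y = ∑[ G ∈ Gs ] (𝟙 (rest G) * 𝟙 (adj G b₀′ v) * 𝟙 (adj G u b₀) * 𝟙 (adj G b₀ b₀′))

  rearrange : ∀ x y z → x * y * z ≡ y * (x * z)
  rearrange = solve-∀
  swap : ∀ x y z → x * (y * z) ≡ y * (x * z)
  swap = solve-∀

  b₀≢b : ∀ j → b (suc j) ≢ b₀
  b₀≢b j eq with () ← b-injective eq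
  b₀′≢b′ : ∀ j → b′ (suc j) ≢ b₀′
  b₀′≢b′ j eq with () ← b′-injective eq

  bridge-cong : ∀ (G H : Graph n) {c c′} → adj G c′ v ≡ adj H c′ v → adj G u c ≡ adj H u c →
                adj G c c′ ≡ adj H c c′ → bridge G u v c c′ ≡ bridge H u v c c′
  bridge-cong G H p q r = cong₂ _∧_ (cong₂ _∧_ p q) r

  rest-cong : ∀ G H → (∀ j → bridge G u v (b (suc j)) (b′ (suc j)) ≡ bridge H u v (b (suc j)) (b′ (suc j))) →
              𝟙 (rest G) ≡ 𝟙 (rest H)
  rest-cong G H p = cong 𝟙 (⋀-cong (cong not ∘ p))

  -- The three arguments treat the edges `b′ v`, `u b` and `b b′` of a later bridge. The second is
  -- compared through its column `b`, since its row `u` may coincide with `v`.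
  half₁ : 2 * (∑[ G ∈ Gs ] (𝟙 (rest G) * 𝟙 (adj G b₀′ v))) ≡ S
  half₁ = ∑-half b₀′ v (b′≢v zero) _ λ {G} {H} a → rest-cong G H λ j → bridge-cong G H
    (a _ (b₀′≢b′ j) (b′≢v _) _)
    (agree-sym G H a _ (b≢b′ _ _) (b≢v _) _)
    (a _ (b≢b′ _ _) (b≢v _) _)

  half₂ : 2 * (∑[ G ∈ Gs ] (𝟙 (rest G) * 𝟙 (adj G b₀′ v) * 𝟙 (adj G u b₀))) ≡
          (∑[ G ∈ Gs ] (𝟙 (rest G) * 𝟙 (adj G b₀′ v)))
  half₂ = ∑-half u b₀ (≢-sym (b≢u zero)) _ λ {G} {H} a → cong₂ _*_
    (rest-cong G H λ j → bridge-cong G H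
      (a _ (b′≢u _) (≢-sym (b≢b′ _ _)) _)
      (agree-sym G H a _ (b≢u _) (b₀≢b j) _)
      (a _ (b≢u _) (b₀≢b j) _))
    (cong 𝟙 (a _ (b′≢u _) (≢-sym (b≢b′ _ _)) _))

  half₃ : 2 * Y ≡ (∑[ G ∈ Gs ] (𝟙 (rest G) * 𝟙 (adj G b₀′ v) * 𝟙 (adj G u b₀)))
  half₃ = ∑-half b₀ b₀′ (b≢b′ zero zero) _ λ {G} {H} a → cong₂ _*_ (cong₂ _*_
    (rest-cong G H λ j → bridge-cong G H
      (a _ (≢-sym (b≢b′ _ _)) (b₀′≢b′ j) _)
      (agree-sym G H a _ (b₀≢b j) (b≢b′ _ _) _)
      (a _ (b₀≢b j) (b≢b′ _ _) _))
    (cong 𝟙 (agree-sym G H a _ (≢-sym (b≢v _)) (≢-sym (b′≢v _)) _)))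
    (cong 𝟙 (a _ (≢-sym (b≢u _)) (≢-sym (b′≢u _)) _))

  8Y≡S : 8 * Y ≡ S
  8Y≡S = trans (eight Y) (trans (cong (λ t → 2 * (2 * t)) half₃) (trans (cong (2 *_) half₂) half₁))
    where
    eight : ∀ t → 8 * t ≡ 2 * (2 * (2 * t))
    eight = solve-∀

  X+Y≡S : X + Y ≡ S
  X+Y≡S = trans (sym (∑-distrib-+ Gs _ _)) (∑-cong Gs λ G → split G)
    where
    collect : ∀ x r p q t → x * r + r * p * q * t ≡ (p * q * t + x) * r
    collect = solve-∀
    split : ∀ G → 𝟙 (not (g G)) * 𝟙 (rest G) + 𝟙 (rest G) * 𝟙 (adj G b₀′ v) * 𝟙 (adj G u b₀) * 𝟙 (adj G b₀ b₀′) ≡ 𝟙 (rest G)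
    split G = begin
      _ ≡⟨ collect (𝟙 (not (g G))) (𝟙 (rest G)) (𝟙 (adj G b₀′ v)) (𝟙 (adj G u b₀)) (𝟙 (adj G b₀ b₀′)) ⟩
      (𝟙 (adj G b₀′ v) * 𝟙 (adj G u b₀) * 𝟙 (adj G b₀ b₀′) + 𝟙 (not (g G))) * 𝟙 (rest G)
        ≡⟨ cong (λ t → (t * 𝟙 (adj G b₀ b₀′) + 𝟙 (not (g G))) * 𝟙 (rest G)) (𝟙-∧ (adj G b₀′ v) (adj G u b₀)) ⟨
      (𝟙 (adj G b₀′ v ∧ adj G u b₀) * 𝟙 (adj G b₀ b₀′) + 𝟙 (not (g G))) * 𝟙 (rest G)
        ≡⟨ cong (λ t → (t + 𝟙 (not (g G))) * 𝟙 (rest G)) (𝟙-∧ (adj G b₀′ v ∧ adj G u b₀) (adj G b₀ b₀′)) ⟨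
      (𝟙 (g G) + 𝟙 (not (g G))) * 𝟙 (rest G)
        ≡⟨ cong (_* 𝟙 (rest G)) (𝟙-not (g G)) ⟩
      1 * 𝟙 (rest G)
        ≡⟨ *-identityˡ _ ⟩
      𝟙 (rest G) ∎

  8X≡7S : 8 * X ≡ 7 * S
  -- Adding `S`, which equals `8 * Y`, to both sides avoids subtraction of natural numbers.
  8X≡7S = +-cancelʳ-≡ S (8 * X) (7 * S) (begin
    8 * X + S      ≡⟨ cong (8 * X +_) 8Y≡S ⟨
    8 * X + 8 * Y  ≡⟨ *-distribˡ-+ 8 X Y ⟨
    8 * (X + Y)    ≡⟨ cong (8 *_) X+Y≡S ⟩
    8 * S          ≡⟨ *-distribʳ-+ S 7 1 ⟩
    7 * S + 1 * S  ≡⟨ cong (7 * S +_) (*-identityˡ S) ⟩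
    7 * S + S      ∎)

-- The two-coloring and its proper paths.

side : Fin 4 → Bool
side zero                = false
side (suc zero)          = true
side (suc (suc zero))    = false
side (suc (suc (suc _))) = true

residue : Fin n → Fin 4
residue v = toℕ v mod 4

class : Fin n → Bool
class v = side (residue v)

abstract
  -- If `x` and `y` lie on the same side, `s` and `r` are the two residues of the other side.
  -- Otherwise `s` is the second residue on the side of `x`, and `r` the second on the side of `y`.
  -- A finite search over residues verifies all cases.
  choose : ∀ x y → ∃₂ λ s r → side s ≢ side y × side r ≢ side x × s ≢ r × s ≢ x × s ≢ y × r ≢ x × r ≢ y
  choose = from-yes (all? λ x → all? λ y → any? λ s → any? λ r →
    ¬? (side s Boolₚ.≟ side y) ×-dec ¬? (side r Boolₚ.≟ side x) ×-dec
    ¬? (s Finₚ.≟ r) ×-dec ¬? (s Finₚ.≟ x) ×-dec ¬? (s Finₚ.≟ y) ×-dec ¬? (r Finₚ.≟ x) ×-dec ¬? (r Finₚ.≟ y))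

paint : Bool → Bool → Fin 2
paint a b = if a xor b then zero else suc zero

-- `a xor b` equals `b xor c` only if `a` equals `c`. Properness at an inner vertex of a path thus
-- depends only on the classes of its two neighbors there.
paint-≢ : ∀ a b c → c ≢ a → paint a b ≢ paint b c
paint-≢ false b     false c≢a = contradiction refl c≢a
paint-≢ true  b     true  c≢a = contradiction refl c≢a
paint-≢ false false true  _   = λ ()
paint-≢ false true  true  _   = λ ()
paint-≢ true  false false _   = λ ()
paint-≢ true  true  false _   = λ ()

coloring : (G : Graph n) → EdgeColoring G 2
coloring G = record
  { color     = λ u v _ → paint (class u) (class v)
  ; color-sym = λ u v _ → cong (λ c → if c then zero else suc zero) (xor-comm (class v) (class u))
  }

-- The two class conditions concern vertices at distance two on the path: `u` and `b′` around `b`,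
-- and `b` and `v` around `b′`. That is what `paint-≢` asks for.
bridge⇒properPath : ∀ (G : Graph n) {u v b b′} → class b ≢ class v → class b′ ≢ class u →
  u ≢ v → u ≢ b → u ≢ b′ → b ≢ b′ → b ≢ v → b′ ≢ v → bridge G u v b b′ ≡ true →
  ∃[ w ] IsProperPath (coloring G) {u} {v} w
bridge⇒properPath G {u} {v} {b} {b′} cb cb′ u≢v u≢b u≢b′ b≢b′ b≢v b′≢v g
  with e₁₂ , bb′ ← Equivalence.to (T-∧ {adj G b′ v ∧ adj G u b}) (Equivalence.from T-≡ g)
  with b′v , ub ← Equivalence.to (T-∧ {adj G b′ v}) e₁₂ =
  ub ◅ bb′ ◅ b′v ◅ ε ,
  (u≢b ∷ u≢b′ ∷ u≢v ∷ []) ∷ (b≢b′ ∷ b≢v ∷ []) ∷ (b′≢v ∷ []) ∷ [] ∷ [] ,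
  paint-≢ (class u) (class b) (class b′) cb′ ∷
  paint-≢ (class b) (class b′) (class v) (≢-sym cb) ∷ [-]

-- Candidate paths from `m` blocks of four consecutive vertices.

module _ {n} m (le : m * 4 ≤ n) where

  vertex : Fin 4 → Fin m → Fin n
  vertex s j = inject≤ (combine j s) le

  vertex-injective : ∀ s {i j} → vertex s i ≡ vertex s j → i ≡ j
  vertex-injective s {i} {j} eq = combine-injectiveˡ i s j s (inject≤-injective le le _ _ eq)

  residue-vertex : ∀ s j → residue (vertex s j) ≡ s
  residue-vertex s j = toℕ-injective (begin
    toℕ (residue (vertex s j))     ≡⟨ toℕ-fromℕ< _ ⟩
    toℕ (vertex s j) % 4           ≡⟨ cong (_% 4) (trans (toℕ-inject≤ _ le) (toℕ-combine j s)) ⟩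
    (4 * toℕ j + toℕ s) % 4        ≡⟨ cong (_% 4) (trans (+-comm (4 * toℕ j) _) (cong (toℕ s +_) (*-comm 4 (toℕ j)))) ⟩
    (toℕ s + toℕ j * 4) % 4        ≡⟨ [m+kn]%n≡m%n (toℕ s) (toℕ j) 4 ⟩
    toℕ s % 4                      ≡⟨ m<n⇒m%n≡m (toℕ<n s) ⟩
    toℕ s                          ∎)
    where open ≡-Reasoning

  left right : Fin n → Fin n → Fin m → Fin n
  left  u v = vertex (proj₁ (choose (residue u) (residue v)))
  right u v = vertex (proj₁ (proj₂ (choose (residue u) (residue v))))

  -- Within one family the block index tells vertices apart; all other inequalities hold already for
  -- residues modulo 4.
  separated : ∀ u v → Separated u v (left u v) (right u v)
  separated u v
    with s , r , _ , _ , s≢r , s≢u , s≢v , r≢u , r≢v ← choose (residue u) (residue v) = record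
    { b-injective  = vertex-injective s
    ; b′-injective = vertex-injective r
    ; b≢b′ = λ i j eq → s≢r (trans (sym (residue-vertex s i)) (trans (cong residue eq) (residue-vertex r j)))
    ; b≢u  = avoid s≢u
    ; b≢v  = avoid s≢v
    ; b′≢u = avoid r≢u
    ; b′≢v = avoid r≢v
    }
    where
    avoid : ∀ {t w} → t ≢ residue w → ∀ i → vertex t i ≢ w
    avoid t≢w i eq = t≢w (trans (sym (residue-vertex _ i)) (cong residue eq))

  missedPair : Graph n → Fin n → Fin n → Bool
  missedPair G u v = missed G u v (left u v) (right u v)

  missedPair-false⇒properPath : ∀ G u v → u ≢ v → missedPair G u v ≡ false →
                                ∃[ w ] IsProperPath (coloring G) {u} {v} w
  missedPair-false⇒properPath G u v u≢v p
    with j , q ← ⋀-false {f = λ j → not (bridge G u v (left u v j) (right u v j))} p =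
    bridge⇒properPath G class-b class-b′ u≢v (≢-sym (b≢u j)) (≢-sym (b′≢u j)) (b≢b′ j j) (b≢v j) (b′≢v j)
      (Boolₚ.not-injective q)
    where
    open Separated (separated u v)
    chosen = proj₂ (proj₂ (choose (residue u) (residue v)))
    class-b : class (left u v j) ≢ class v
    class-b = subst (λ s → side s ≢ class v) (sym (residue-vertex _ j)) (proj₁ chosen)
    class-b′ : class (right u v j) ≢ class u
    class-b′ = subst (λ s → side s ≢ class u) (sym (residue-vertex _ j)) (proj₁ (proj₂ chosen))

-- Sufficient conditions for proper connection number 2.

properlyConnected⇒connected : ∀ {G : Graph n} {k} (c : EdgeColoring G k) → ProperlyConnected c → Connected G
properlyConnected⇒connected c p u v with u Finₚ.≟ v
... | yes refl = ε , [] ∷ []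
... | no u≢v with w , path , _ ← p u v u≢v = w , path

Fin-irrelevant : ∀ {j} → j < 2 → (a b : Fin j) → a ≡ b
Fin-irrelevant {1} _ zero zero = refl
Fin-irrelevant {suc (suc _)} (s≤s (s≤s ()))

-- With at most one color, two consecutive edges always agree in color, so a proper path between
-- distinct vertices is a single edge.
monochromatic⇒complete : ∀ {G : Graph n} {j} → j < 2 → ProperlyConnectable G j → ∀ u v → u ≢ v → Adj G u v
monochromatic⇒complete j<2 (c , p) u v u≢v with p u v u≢v
... | ε          , _            = contradiction refl u≢v
... | e ◅ ε      , _            = e
... | _ ◅ _ ◅ _ , _ , c≢c′ ∷ _ = contradiction (Fin-irrelevant j<2 _ _) c≢c′

-- The number of bad events that occur in `G`, for the union bound: the double sum guards the upper
-- bound 2 on the proper connection number, the last term the lower bound.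
defect : ∀ m → m * 4 ≤ suc n → Graph (suc n) → ℕ
defect {n} m le G =
  (∑[ u ∈ allFin (suc n) ] ∑[ v ∈ allFin (suc n) ] 𝟙 (missedPair m le G u v)) + 𝟙 (dominates G)

𝟙≡0⇒false : ∀ {b} → 𝟙 b ≡ 0 → b ≡ false
𝟙≡0⇒false {false} _ = refl

defect≡0⇒pc2 : ∀ m (le : m * 4 ≤ suc n) (G : Graph (suc n)) → defect m le G ≡ 0 → ConnectedWithPc2 G
defect≡0⇒pc2 {n} m le G eq =
  properlyConnected⇒connected (coloring G) pconn , (coloring G , pconn) , λ j<2 pj →
    -- Fewer than two colors would make `G` complete, against the vanishing last term of the defect.
    -- The one-vertex graph is excluded too, because there `dominates` holds vacuously.
    contradiction (trans (sym (complete⇒dominates (monochromatic⇒complete j<2 pj))) (𝟙≡0⇒false (m+n≡0⇒n≡0 _ eq)))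
                  λ ()
  where
  pconn : ProperlyConnected (coloring G)
  pconn u v u≢v = missedPair-false⇒properPath m le G u v u≢v (𝟙≡0⇒false
    (∑-tabulate≡0 (λ v → v) (λ v → 𝟙 (missedPair m le G u v))
      (∑-tabulate≡0 (λ u → u) (λ u → ∑[ v ∈ allFin (suc n) ] 𝟙 (missedPair m le G u v)) (m+n≡0⇒m≡0 _ eq) u) v))
  complete⇒dominates : (∀ u v → u ≢ v → Adj G u v) → dominates G ≡ true
  complete⇒dominates c = ⋀-true λ v → Equivalence.to T-≡ (c zero (suc v) λ ())

-- The union bound.

countBad : ℕ → ℕ
countBad n = ∑[ G ∈ allGraphs n ] 𝟙 (not (does (connectedWithPc2? G)))

count+bad : ∀ n → countGraphs n connectedWithPc2? + countBad n ≡ 2 ^ (n C 2)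
count+bad n = begin
  countGraphs n connectedWithPc2? + countBad n
    ≡⟨ cong (_+ countBad n) (length-filter connectedWithPc2? (allGraphs n)) ⟩
  (∑[ G ∈ allGraphs n ] 𝟙 (does (connectedWithPc2? G))) + countBad n
    ≡⟨ ∑-distrib-+ (allGraphs n) _ _ ⟨
  (∑[ G ∈ allGraphs n ] (𝟙 (does (connectedWithPc2? G)) + 𝟙 (not (does (connectedWithPc2? G)))))
    ≡⟨ ∑-cong (allGraphs n) (λ G → 𝟙-not (does (connectedWithPc2? G))) ⟩
  (∑[ G ∈ allGraphs n ] 1)
    ≡⟨ ∑-allGraphs-1 n ⟩
  2 ^ (n C 2) ∎
  where open ≡-Reasoning

𝟙-not-does-≤ : ∀ {P : Set} (P? : Dec P) {k} → (k ≡ 0 → P) → 𝟙 (not (does P?)) ≤ k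
𝟙-not-does-≤ (yes _) _ = z≤n
𝟙-not-does-≤ (no ¬p) f = n≢0⇒n>0 (¬p ∘ f)

bad≤defect : ∀ m (le : m * 4 ≤ suc n) (G : Graph (suc n)) →
             𝟙 (not (does (connectedWithPc2? G))) ≤ defect m le G
bad≤defect m le G = 𝟙-not-does-≤ (connectedWithPc2? G) (defect≡0⇒pc2 m le G)

∑-allFin-const : ∀ n c → (∑[ i ∈ allFin n ] c) ≡ n * c
∑-allFin-const n c = trans (∑-const (allFin n) c) (cong (_* c) (length-tabulate {n = n} (λ i → i)))

-- After the sum over graphs is moved inside, `∑-missed` gives every ordered pair the same
-- contribution, including the pairs with `u` equal to `v`.
∑-missedPairs : ∀ m (le : m * 4 ≤ n) →
  8 ^ m * (∑[ G ∈ allGraphs n ] ∑[ u ∈ allFin n ] ∑[ v ∈ allFin n ] 𝟙 (missedPair m le G u v)) ≡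
  n * n * (7 ^ m * 2 ^ (n C 2))
∑-missedPairs {n} m le = begin
  8 ^ m * (∑[ G ∈ allGraphs n ] ∑[ u ∈ allFin n ] ∑[ v ∈ allFin n ] 𝟙 (missedPair m le G u v))
    ≡⟨ cong (8 ^ m *_) (trans (∑-comm (allGraphs n) (allFin n) _)
         (∑-cong (allFin n) λ u → ∑-comm (allGraphs n) (allFin n) _)) ⟩
  8 ^ m * (∑[ u ∈ allFin n ] ∑[ v ∈ allFin n ] ∑[ G ∈ allGraphs n ] 𝟙 (missedPair m le G u v))
    ≡⟨ trans (*-distribˡ-∑ (8 ^ m) (allFin n) _) (∑-cong (allFin n) λ u → *-distribˡ-∑ (8 ^ m) (allFin n) _) ⟩
  (∑[ u ∈ allFin n ] ∑[ v ∈ allFin n ] (8 ^ m * (∑[ G ∈ allGraphs n ] 𝟙 (missedPair m le G u v))))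
    ≡⟨ ∑-cong (allFin n) (λ u → ∑-cong (allFin n) λ v → ∑-missed (separated m le u v)) ⟩
  (∑[ u ∈ allFin n ] ∑[ v ∈ allFin n ] (7 ^ m * 2 ^ (n C 2)))
    ≡⟨ trans (∑-cong (allFin n) λ u → ∑-allFin-const n _) (∑-allFin-const n _) ⟩
  n * (n * (7 ^ m * 2 ^ (n C 2)))
    ≡⟨ *-assoc n n _ ⟨
  n * n * (7 ^ m * 2 ^ (n C 2)) ∎
  where open ≡-Reasoning

-- This puts `8 ^ m` below `2 ^ n`, the number of possible neighborhoods of vertex zero.
3m≤n : ∀ m → m * 4 ≤ suc n → 3 * m ≤ n
3m≤n zero    le = z≤n
3m≤n {n} (suc m) le = begin
  3 * suc m          ≡⟨ *-comm 3 (suc m) ⟩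
  3 + m * 3          ≤⟨ +-monoʳ-≤ 3 (*-monoʳ-≤ m (n≤1+n 3)) ⟩
  3 + m * 4          ≤⟨ s≤s⁻¹ le ⟩
  n                  ∎
  where open ≤-Reasoning

-- Vertex zero dominates with probability `1 / 2 ^ n`, hence at most `1 / 8 ^ m`. The weaker bound
-- with `7 ^ m` lets this term merge with those of the missed pairs.
∑-dominates-≤ : ∀ m n → m * 4 ≤ suc n →
  8 ^ m * (∑[ G ∈ allGraphs (suc n) ] 𝟙 (dominates G)) ≤ 7 ^ m * 2 ^ (suc n C 2)
∑-dominates-≤ m n le = begin
  8 ^ m * (∑[ G ∈ allGraphs (suc n) ] 𝟙 (dominates G))  ≡⟨ cong (8 ^ m *_) (∑-dominates n) ⟩
  8 ^ m * 2 ^ (n C 2)                                    ≡⟨ cong (_* 2 ^ (n C 2)) (^-*-assoc 2 3 m) ⟩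
  2 ^ (3 * m) * 2 ^ (n C 2)                              ≤⟨ *-monoˡ-≤ (2 ^ (n C 2)) (^-monoʳ-≤ 2 (3m≤n m le)) ⟩
  2 ^ n * 2 ^ (n C 2)                                    ≡⟨ sucC2 n ⟨
  2 ^ (suc n C 2)                                        ≡⟨ *-identityˡ _ ⟨
  1 * 2 ^ (suc n C 2)                                    ≤⟨ *-monoˡ-≤ (2 ^ (suc n C 2)) (m^n>0 7 m) ⟩
  7 ^ m * 2 ^ (suc n C 2)                                ∎
  where open ≤-Reasoning

countBad-≤ : ∀ m n → m * 4 ≤ suc n →
  8 ^ m * countBad (suc n) ≤ (suc n * suc n + 1) * (7 ^ m * 2 ^ (suc n C 2))
countBad-≤ m n le = begin
  8 ^ m * countBad (suc n)
    ≤⟨ *-monoʳ-≤ (8 ^ m) (∑-mono-≤ (allGraphs (suc n)) (bad≤defect m le)) ⟩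
  8 ^ m * (∑[ G ∈ allGraphs (suc n) ] defect m le G)
    ≡⟨ cong (8 ^ m *_) (∑-distrib-+ (allGraphs (suc n)) _ (𝟙 ∘ dominates)) ⟩
  8 ^ m * (P + D)
    ≡⟨ *-distribˡ-+ (8 ^ m) P D ⟩
  8 ^ m * P + 8 ^ m * D
    ≤⟨ +-mono-≤ (≤-reflexive (∑-missedPairs m le)) (∑-dominates-≤ m n le) ⟩
  suc n * suc n * X + X
    ≡⟨ cong (suc n * suc n * X +_) (*-identityˡ X) ⟨
  suc n * suc n * X + 1 * X
    ≡⟨ *-distribʳ-+ X (suc n * suc n) 1 ⟨
  (suc n * suc n + 1) * X ∎
  where
  open ≤-Reasoning
  P = ∑[ G ∈ allGraphs (suc n) ] ∑[ u ∈ allFin (suc n) ] ∑[ v ∈ allFin (suc n) ] 𝟙 (missedPair m le G u v)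
  D = ∑[ G ∈ allGraphs (suc n) ] 𝟙 (dominates G)
  X = 7 ^ m * 2 ^ (suc n C 2)

-- Exponential decay against quadratic growth.

-- Bernoulli's inequality for the base 8/7, with denominators cleared.
bernoulli : ∀ k → 7 ^ k * (7 + k) ≤ 7 * 8 ^ k
bernoulli zero    = ≤-refl
bernoulli (suc k) = begin
  7 * 7 ^ k * (8 + k)            ≡⟨ step₁ (7 ^ k) k ⟩
  7 ^ k * (56 + 7 * k)           ≤⟨ *-monoʳ-≤ (7 ^ k) (+-monoʳ-≤ 56 (*-monoˡ-≤ k (n≤1+n 7))) ⟩
  7 ^ k * (56 + 8 * k)           ≡⟨ step₂ (7 ^ k) k ⟩
  8 * (7 ^ k * (7 + k))          ≤⟨ *-monoʳ-≤ 8 (bernoulli k) ⟩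
  8 * (7 * 8 ^ k)                ≡⟨ step₃ (8 ^ k) ⟩
  7 * (8 * 8 ^ k)                ∎
  where
  open ≤-Reasoning
  step₁ : ∀ a k → 7 * a * (8 + k) ≡ a * (56 + 7 * k)
  step₁ = solve-∀
  step₂ : ∀ a k → a * (56 + 8 * k) ≡ 8 * (a * (7 + k))
  step₂ = solve-∀
  step₃ : ∀ a → 8 * (7 * a) ≡ 7 * (8 * a)
  step₃ = solve-∀

cube : ℕ → ℕ
cube x = x * x * x

^-3 : ∀ a k → a ^ (k * 3) ≡ cube (a ^ k)
^-3 a k = trans (sym (^-*-assoc a k 3)) (lemma (a ^ k))
  where
  lemma : ∀ x → x * (x * (x * 1)) ≡ x * x * x
  lemma = solve-∀

cube-mono-≤ : ∀ {x y} → x ≤ y → cube x ≤ cube y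
cube-mono-≤ p = *-mono-≤ (*-mono-≤ p p) p

-- Bernoulli's inequality, cubed: (8/7)^(3k) ≥ (1 + k/7)³, which is cubic in k.

exponential-dominates : ∀ q c k → q * (c * c) * cube 7 ≤ k →
  q * ((suc k * c) * (suc k * c)) * 7 ^ (k * 3) < 8 ^ (k * 3)
exponential-dominates q c k large = *-cancelˡ-< (cube 7) _ _ (begin-strict
  cube 7 * (q * ((suc k * c) * (suc k * c)) * 7 ^ (k * 3))
    ≡⟨ cong (λ t → cube 7 * (q * ((suc k * c) * (suc k * c)) * t)) (^-3 7 k) ⟩
  cube 7 * (q * ((suc k * c) * (suc k * c)) * cube a)
    ≡⟨ rearrange (cube 7) q (suc k) c (cube a) ⟩
  q * (c * c) * cube 7 * (suc k * suc k * cube a)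
    ≤⟨ *-monoˡ-≤ _ large ⟩
  -- The hypothesis has absorbed all constants into one factor `k`. What remains is cubic in `k`,
  -- and strictness comes from `k < 7 + k`.
  k * (suc k * suc k * cube a)
    <⟨ *-monoˡ-< _ {{m*n≢0 (suc k * suc k) (cube a) {{_}} {{cube≢0}}}} (m≤n+m (suc k) 6) ⟩
  (7 + k) * (suc k * suc k * cube a)
    ≤⟨ *-monoʳ-≤ (7 + k) (*-monoˡ-≤ (cube a) (*-mono-≤ 1+k≤7+k 1+k≤7+k)) ⟩
  (7 + k) * ((7 + k) * (7 + k) * cube a)
    ≡⟨ cube-* (7 + k) a ⟩
  cube (a * (7 + k))
    ≤⟨ cube-mono-≤ (bernoulli k) ⟩
  cube (7 * 8 ^ k)
    ≡⟨ cube-distrib 7 (8 ^ k) ⟩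
  cube 7 * cube (8 ^ k)
    ≡⟨ cong (cube 7 *_) (^-3 8 k) ⟨
  cube 7 * 8 ^ (k * 3) ∎)
  where
  open ≤-Reasoning
  a = 7 ^ k
  1+k≤7+k : suc k ≤ 7 + k
  1+k≤7+k = m≤n+m (suc k) 6
  cube≢0 : NonZero (cube a)
  cube≢0 = m*n≢0 (a * a) a {{m*n≢0 a a {{m^n≢0 7 k}} {{m^n≢0 7 k}}}} {{m^n≢0 7 k}}
  rearrange : ∀ d q s c x → d * (q * ((s * c) * (s * c)) * x) ≡ q * (c * c) * d * (s * s * x)
  rearrange = solve-∀
  cube-* : ∀ s a → s * (s * s * (a * a * a)) ≡ a * s * (a * s) * (a * s)
  cube-* = solve-∀
  cube-distrib : ∀ x y → x * y * (x * y) * (x * y) ≡ x * x * x * (y * y * y)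
  cube-distrib = solve-∀

-- From counts to rational proportions.

toℚᵘ-/ : ∀ i d .{{_ : NonZero d}} → toℚᵘ (i ℚ./ d) ℚᵘ.≃ i ℚᵘ./ d
toℚᵘ-/ i (suc d) = ℚₚ.toℚᵘ-fromℚᵘ (mkℚᵘ i d)

/-+-≡1 : ∀ a b d .{{_ : NonZero d}} → a + b ≡ d → (ℤ.+ a) ℚ./ d ℚ.+ (ℤ.+ b) ℚ./ d ≡ 1ℚ
/-+-≡1 a b (suc d) eq = ℚₚ.toℚᵘ-injective (begin
  toℚᵘ ((ℤ.+ a) ℚ./ suc d ℚ.+ (ℤ.+ b) ℚ./ suc d)
    ≈⟨ ℚₚ.toℚᵘ-homo-+ ((ℤ.+ a) ℚ./ suc d) ((ℤ.+ b) ℚ./ suc d) ⟩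
  toℚᵘ ((ℤ.+ a) ℚ./ suc d) ℚᵘ.+ toℚᵘ ((ℤ.+ b) ℚ./ suc d)
    ≈⟨ ℚᵘₚ.+-cong (toℚᵘ-/ (ℤ.+ a) (suc d)) (toℚᵘ-/ (ℤ.+ b) (suc d)) ⟩
  mkℚᵘ (ℤ.+ a) d ℚᵘ.+ mkℚᵘ (ℤ.+ b) d
    ≈⟨ ℚᵘ.*≡* cross ⟩
  toℚᵘ 1ℚ ∎)
  where
  open ℚᵘₚ.≃-Reasoning
  D = ℤ.+ suc d
  cross : (ℤ.+ a ℤ.* D ℤ.+ ℤ.+ b ℤ.* D) ℤ.* ℤ.+ 1 ≡ ℤ.+ 1 ℤ.* (ℤ.+ (suc d * suc d))
  cross = trans (ℤₚ.*-identityʳ _) (trans (sym (ℤₚ.*-distribʳ-+ D (ℤ.+ a) (ℤ.+ b)))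
    (trans (cong (λ t → ℤ.+ t ℤ.* D) eq) (sym (trans (ℤₚ.*-identityˡ (ℤ.+ (suc d * suc d))) (ℤₚ.pos-* (suc d) (suc d))))))

-- The distance from `a / d` to 1 is `b / d`. A positive rational with denominator `q` is at least
-- `1 / q`, so `q * b < d` suffices.
close-to-1 : ∀ a b d .{{_ : NonZero d}} → a + b ≡ d →
             ∀ δ → 0ℚ ℚ.< δ → ℚ.denominatorℕ δ * b < d → ℚ.∣ (ℤ.+ a) ℚ./ d ℚ.- 1ℚ ∣ ℚ.< δ
close-to-1 a b d@(suc d-1) eq (mkℚ ℤ.+0 _ _)       (ℚ.*<* (ℤ.+<+ ()))
close-to-1 a b d@(suc d-1) eq (mkℚ ℤ.-[1+ _ ] _ _) (ℚ.*<* ())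
close-to-1 a b d@(suc d-1) eq δ@(mkℚ ℤ.+[1+ p ] q-1 _) 0<δ small = begin-strict
  ℚ.∣ x ℚ.- 1ℚ ∣           ≡⟨ cong (λ t → ℚ.∣ x ℚ.- t ∣) (/-+-≡1 a b d eq) ⟨
  ℚ.∣ x ℚ.- (x ℚ.+ y) ∣    ≡⟨ cong ℚ.∣_∣ x-[x+y]≡-y ⟩
  ℚ.∣ ℚ.- y ∣              ≡⟨ ℚₚ.∣-p∣≡∣p∣ y ⟩
  ℚ.∣ y ∣                  ≡⟨ ℚₚ.0≤p⇒∣p∣≡p (ℚₚ.nonNegative⁻¹ y {{ℚₚ.normalize-nonNeg b d}}) ⟩
  y                        <⟨ y<δ ⟩
  δ                        ∎
  where
  open ℚₚ.≤-Reasoning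
  x = (ℤ.+ a) ℚ./ d
  y = (ℤ.+ b) ℚ./ d
  x-[x+y]≡-y : x ℚ.- (x ℚ.+ y) ≡ ℚ.- y
  x-[x+y]≡-y = trans (cong (x ℚ.+_) (ℚₚ.neg-distrib-+ x y))
    (trans (sym (ℚₚ.+-assoc x (ℚ.- x) (ℚ.- y))) (trans (cong (ℚ._- y) (ℚₚ.+-inverseʳ x)) (ℚₚ.+-identityˡ (ℚ.- y))))
  y<δ : y ℚ.< δ
  y<δ = ℚₚ.toℚᵘ-cancel-< (ℚᵘₚ.<-respˡ-≃ (ℚᵘₚ.≃-sym (toℚᵘ-/ (ℤ.+ b) d)) (ℚᵘ.*<* cross))
    where
    cross : ℤ.+ b ℤ.* ℤ.+ suc q-1 ℤ.< ℤ.+[1+ p ] ℤ.* ℤ.+ d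
    cross = subst₂ ℤ._<_ (ℤₚ.pos-* b (suc q-1)) (ℤₚ.pos-* (suc p) d)
      (ℤ.+<+ (<-≤-trans (subst (_< d) (*-comm (suc q-1) b) small) (m≤n*m d (suc p))))

n*n+1≤ : ∀ {x} → n < x → n * n + 1 ≤ x * x
n*n+1≤ {n} {x} n<x = begin
  n * n + 1        ≤⟨ +-monoʳ-≤ (n * n) (s≤s z≤n) ⟩
  n * n + suc (n + n)  ≡⟨ square n ⟩
  suc n * suc n    ≤⟨ *-mono-≤ n<x n<x ⟩
  x * x            ∎
  where
  open ≤-Reasoning
  square : ∀ n → n * n + (1 + (n + n)) ≡ (1 + n) * (1 + n)
  square = solve-∀

n<[1+n/d]*d : ∀ n d .{{_ : NonZero d}} → n < suc (n / d) * d
n<[1+n/d]*d n d = begin-strict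
  n                    ≡⟨ m≡m%n+[m/n]*n n d ⟩
  n % d + n / d * d    <⟨ +-monoˡ-< (n / d * d) (m%n<n n d) ⟩
  suc (n / d) * d      ∎
  where open ≤-Reasoning

-- The hypothesis is that of `exponential-dominates` with `c` equal to 12; its last factor 12 turns
-- the lower bound on `suc n / 12` into one on `suc n`.
countBad-negligible : ∀ q n → q * (12 * 12) * cube 7 * 12 ≤ suc n →
                      q * countBad (suc n) < 2 ^ (suc n C 2)
countBad-negligible q n large = *-cancelˡ-< (8 ^ r) _ _ (begin-strict
  8 ^ r * (q * countBad (suc n))
    ≡⟨ swap (8 ^ r) q (countBad (suc n)) ⟩
  q * (8 ^ r * countBad (suc n))
    ≤⟨ *-monoʳ-≤ q (countBad-≤ r n 4r≤n) ⟩
  q * ((suc n * suc n + 1) * (7 ^ r * E))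
    ≤⟨ *-monoʳ-≤ q (*-monoˡ-≤ (7 ^ r * E) (n*n+1≤ (n<[1+n/d]*d (suc n) 12))) ⟩
  q * ((suc k * 12) * (suc k * 12) * (7 ^ r * E))
    ≡⟨ regroup q ((suc k * 12) * (suc k * 12)) (7 ^ r) E ⟩
  q * ((suc k * 12) * (suc k * 12)) * 7 ^ r * E
    <⟨ *-monoˡ-< E {{m^n≢0 2 (suc n C 2)}} (exponential-dominates q 12 k large′) ⟩
  8 ^ r * E ∎)
  where
  open ≤-Reasoning
  -- Twelve is four vertices per block times three: the number `r` of blocks must be a multiple of 3
  -- for the cubed Bernoulli inequality.
  k = suc n / 12
  r = k * 3
  E = 2 ^ (suc n C 2)
  4r≤n : r * 4 ≤ suc n
  4r≤n = subst (_≤ suc n) (sym (*-assoc k 3 4)) (m/n*n≤m (suc n) 12)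
  large′ : q * (12 * 12) * cube 7 ≤ k
  large′ = subst (_≤ k) (m*n/n≡m (q * (12 * 12) * cube 7) 12) (/-monoˡ-≤ 12 large)
  swap : ∀ x y z → x * (y * z) ≡ y * (x * z)
  swap = solve-∀
  regroup : ∀ q x y z → q * (x * (y * z)) ≡ q * x * y * z
  regroup = solve-∀

theorem1p6 : AlmostAll ConnectedWithPc2 connectedWithPc2?
theorem1p6 δ 0<δ = suc N , bound
  where
  N = ℚ.denominatorℕ δ * (12 * 12) * cube 7 * 12
  bound : ∀ n → suc N ≤ n → ℚ.∣ proportion ConnectedWithPc2 connectedWithPc2? n ℚ.- 1ℚ ∣ ℚ.< δ
  -- Starting from `suc N` guarantees at least one vertex, as the union bound requires.
  bound (suc n) (s≤s N≤n) =
    close-to-1 _ (countBad (suc n)) (2 ^ (suc n C 2)) {{m^n≢0 2 (suc n C 2)}} (count+bad (suc n)) δ 0<δ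
      (countBad-negligible (ℚ.denominatorℕ δ) n (m≤n⇒m≤1+n N≤n))
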